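{- Let $G$ be a finite simple graph on $n$ vertices. Then there exists a finite simple graph $\widehat{G}$ such that \[ h(G,x)=x^{n}\,I(\widehat{G},1/x). \]
   Context: For a graph $G$ on $n$ vertices, let $a_k(G)$ denote the number of ways to cover all vertices of $G$ by exactly $k$ pairwise disjoint cliques of $G$ (i.e. the number of partitions of $V(G)$ into exactly $k$ parts, each inducing a complete subgraph). The adjoint polynomial of $G$ is $h(G,x)=\sum_{k=1}^n(-1)^{n-k}a_k(G)x^k$. For a graph $H$, the independence polynomial is $I(H,x)=\sum_{k\ge 0}(-1)^k i_k(H)x^k$, where $i_k(H)$ is the number of independent sets of size $k$ in $H$ (so $i_0(H)=1$). -}

module Defs where

open import Algebra.Bundles using (CommutativeRing)
open import Data.Bool.Base using (true; false)
open import Data.Fin.Base using (Fin; toℕ)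
open import Data.Fin.Properties using (all?) renaming (_≟_ to _≟ᶠ_)
open import Data.Fin.Subset using (Subset; _∈_; _∩_; ∣_∣; ⋃; ⊤; Nonempty; Empty)
open import Data.Fin.Subset.Properties using (_∈?_; nonempty?)
open import Data.List.Base
  using (List; []; _∷_; [_]; _++_; map; filter; length; cartesianProductWith)
open import Data.List.Relation.Unary.All as All using (All)
open import Data.List.Relation.Unary.AllPairs using (AllPairs; allPairs?)
open import Data.Nat.Base using (ℕ; zero; suc; _∸_)
open import Data.Nat.Properties using () renaming (_≟_ to _≟ⁿ_)
open import Data.Product.Base using (_×_)
open import Data.Vec.Base as Vec using ()
open import Data.Vec.Properties using (≡-dec)
import Data.Bool.Properties as Bool
open import Level using (0ℓ)
open import Relation.Binary.Core using (Rel)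
open import Relation.Binary.Definitions using (Decidable; Symmetric)
open import Relation.Binary.PropositionalEquality.Core using (_≡_; _≢_)
open import Relation.Nullary.Decidable using (Dec; ¬?; _×-dec_; _→-dec_)
open import Relation.Nullary.Negation.Core using (¬_)
import Algebra.Properties.Semiring.Exp
import Algebra.Properties.Semiring.Mult
import Algebra.Properties.Semiring.Sum

record Graph (n : ℕ) : Set₁ where
  infix 4 _∼_ _∼?_
  field
    _∼_      : Rel (Fin n) 0ℓ
    _∼?_     : Decidable _∼_
    ∼-sym    : Symmetric _∼_
    ∼-irrefl : ∀ v → ¬ (v ∼ v)

private
  variable
    n : ℕ

module _ (G : Graph n) where
  open Graph G

  IsClique : Subset n → Set
  IsClique S = ∀ u v → u ∈ S → v ∈ S → u ≢ v → u ∼ v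

  IsIndependent : Subset n → Set
  IsIndependent S = ∀ u v → u ∈ S → v ∈ S → ¬ (u ∼ v)

  isClique? : ∀ S → Dec (IsClique S)
  isClique? S = all? λ u → all? λ v →
    (u ∈? S) →-dec (v ∈? S) →-dec ¬? (u ≟ᶠ v) →-dec (u ∼? v)

  isIndependent? : ∀ S → Dec (IsIndependent S)
  isIndependent? S = all? λ u → all? λ v →
    (u ∈? S) →-dec (v ∈? S) →-dec ¬? (u ∼? v)

  IsCliquePartition : List (Subset n) → Set
  IsCliquePartition P =
    All Nonempty P × AllPairs (λ S T → Empty (S ∩ T)) P × ⋃ P ≡ ⊤ × All IsClique P

  isCliquePartition? : ∀ P → Dec (IsCliquePartition P)
  isCliquePartition? P =
    All.all? nonempty? P
      ×-dec allPairs? (λ S T → ¬? (nonempty? (S ∩ T))) P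
      ×-dec ≡-dec Bool._≟_ (⋃ P) ⊤
      ×-dec All.all? isClique? P

subsets : ∀ n → List (Subset n)
subsets zero    = [ Vec.[] ]
subsets (suc n) = cartesianProductWith Vec._∷_ (true ∷ false ∷ []) (subsets n)

sublists : ∀ {A : Set} → List A → List (List A)
sublists []       = [ [] ]
sublists (x ∷ xs) = map (x ∷_) (sublists xs) ++ sublists xs

-- An unordered family of distinct vertex sets is encoded, uniquely, as a sublist
-- of the duplicate-free list `subsets n`; so partitions are counted without
-- regard to the order of their parts.
cliquePartitionCount : Graph n → ℕ → ℕ
cliquePartitionCount {n} G k =
  length (filter (λ P → (length P ≟ⁿ k) ×-dec isCliquePartition? G P)
                 (sublists (subsets n)))

independentSetCount : Graph n → ℕ → ℕ
independentSetCount {n} G k =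
  length (filter (λ S → (∣ S ∣ ≟ⁿ k) ×-dec isIndependent? G S) (subsets n))

-- The values of the two polynomials at an element x of a commutative ring R.
-- A polynomial with integer coefficients is determined by its values in all
-- commutative rings (evaluate at the indeterminate of ℤ[x]).
module _ {c ℓ} (R : CommutativeRing c ℓ) where
  open CommutativeRing R
  open Algebra.Properties.Semiring.Exp semiring using (_^_)
  open Algebra.Properties.Semiring.Mult semiring using () renaming (_×_ to _·_)
  open Algebra.Properties.Semiring.Sum semiring using (sum-syntax; sum⁺-syntax)

  -- The index i of the sum stands for k = i + 1, so that k runs from 1 to n.
  adjointPolynomial : Graph n → Carrier → Carrier
  adjointPolynomial {n} G x =
    ∑[ i < n ] (let k = suc (toℕ i) in
      (- 1#) ^ (n ∸ k) * (cliquePartitionCount G k · x ^ k))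

  -- A graph on m vertices has no independent set of more than m vertices.
  independencePolynomial : ∀ {m} → Graph m → Carrier → Carrier
  independencePolynomial {m} H x =
    ∑[ i ≤ m ] (let k = toℕ i in
      (- 1#) ^ k * (independentSetCount H k · x ^ k))

{-# OPTIONS --safe #-}

-- Order the vertices of G and let every part of a clique partition be represented
-- by the star joining its least vertex (its root) to its other vertices.  A partition
-- into k parts becomes a set of n − k edges of G, and the edge sets (i , j), i < j,
-- arising in this way are cut out by conditions on pairs of edges: no two edges have
-- the same upper end, no upper end is a lower end, and the upper ends of two edges
-- with a common lower end are adjacent.  Hence they are the independent sets of a
-- graph Ĝ on the edges of G, and a_k(G) = i_{n-k}(Ĝ).

module Submission where

open import Defs
open import Algebra.Bundles using (CommutativeRing)
open import Data.Nat.Base using (ℕ; NonZero)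
open import Data.Product.Base using (Σ-syntax; ∃-syntax)
import Algebra.Properties.Semiring.Exp

open import Data.Bool.Base using (true; false)
open import Data.Empty using (⊥-elim)
open import Data.Fin.Base using (Fin; toℕ; fromℕ<; zero; suc; _≤_; _<_; opposite)
open import Data.Fin.Permutation using (reverse)
open import Data.Fin.Properties
  using (any?; _≟_; _<?_; suc-injective; injective⇒≤; toℕ<n; opposite-prop)
  renaming (≤-antisym to ≤ᶠ-antisym; ≤-refl to ≤ᶠ-refl; ≤∧≢⇒< to ≤∧≢⇒<ᶠ; <⇒≢ to <ᶠ⇒≢)
open import Data.Fin.Subset using (Subset; _∈_; ∣_∣; ⋃; ∁)
open import Data.Fin.Subset.Properties
  using ( _∈?_; ∈⊤; ∉⊥; ⊆-antisym; ⊆⊤; x∈p∪q⁺; x∈p∪q⁻; x∈p∩q⁺; x∈p∩q⁻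
        ; x∈∁p⇒x∉p; x∉p⇒x∈∁p; ∣p∣≤n; ∣∁p∣≡n∸∣p∣; ∣p∣≡n⇒p≡⊤)
open import Data.List.Base
  using (List; []; _∷_; map; filter; length; lookup; allFin; cartesianProduct)
open import Data.List.Membership.Propositional using (find; lose) renaming (_∈_ to _∈ˡ_)
open import Data.List.Membership.Propositional.Properties
  using ( ∈-lookup; ∈-filter⁺; ∈-filter⁻; ∈-allFin; ∈-cartesianProduct⁺; ∈-map⁺; ∈-map⁻
        ; ∈-cartesianProductWith⁺; ∈-++⁺ˡ; ∈-++⁺ʳ; ∈-++⁻; ∈-AllPairs₂)
open import Data.List.Properties using (filter-none; length-map)
open import Data.List.Relation.Unary.All as All using (All; []; _∷_)
open import Data.List.Relation.Unary.AllPairs using (AllPairs; []; _∷_)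
open import Data.List.Relation.Unary.Any as Any using (Any; here; there)
open import Data.List.Relation.Unary.Any.Properties using (lookup-index)
open import Data.List.Relation.Unary.Unique.Propositional using (Unique)
import Data.List.Relation.Unary.Unique.Propositional.Properties as Unique
import Data.Nat.Base as ℕ
import Data.Nat.Properties as ℕ
open import Data.Product.Base using (∃; _×_; _,_; proj₁; proj₂)
open import Data.Sum.Base using (_⊎_; inj₁; inj₂)
open import Data.Vec.Base using (here; there; tabulate) renaming ([] to []ᵛ; _∷_ to _∷ᵛ_)
open import Data.Vec.Properties using (lookup∘tabulate; []=⇒lookup; lookup⇒[]=; ∷-injective; ≡-dec)
import Data.Bool.Properties as Bool
open import Function.Base using (_∘_; case_of_)
open import Function.Bundles using (_⇔_; mk⇔; Equivalence)
open import Relation.Binary.PropositionalEquality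
  using (_≡_; _≢_; refl; sym; trans; cong; cong₂; subst; subst₂)
open import Relation.Nullary
  using (Dec; yes; no; does; ¬_; contradiction; ¬?; _×-dec_; _⊎-dec_)
open import Relation.Nullary.Decidable using (decidable-stable; dec-true)
open import Relation.Unary using (Decidable)
import Algebra.Properties.Semiring.Mult
import Algebra.Properties.Semiring.Sum
import Algebra.Properties.CommutativeSemiring.Exp
import Relation.Binary.Reasoning.Setoid

open Equivalence using (to; from)

private
  variable
    n : ℕ
    A B : Set

-- Counting by relations between lists

lookup-injective : ∀ {xs : List A} → Unique xs → ∀ i j → lookup xs i ≡ lookup xs j → i ≡ j
lookup-injective (_  ∷ _)  zero    zero    _  = refl
lookup-injective (x∉ ∷ _)  zero    (suc j) eq = contradiction eq (All.lookup x∉ (∈-lookup j))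
lookup-injective (x∉ ∷ _)  (suc i) zero    eq = contradiction (sym eq) (All.lookup x∉ (∈-lookup i))
lookup-injective (_  ∷ xs) (suc i) (suc j) eq = cong suc (lookup-injective xs i j eq)

-- Choosing a partner in `ys` for every position of `xs` gives a map of index sets, injective
-- because elements of `xs` sharing a partner coincide. A relation is used because partitions and
-- edge sets will be linked through an existential witness.
length-≤-by-relation :
  (R : A → B → Set) {xs : List A} {ys : List B} → Unique xs →
  (∀ {x} → x ∈ˡ xs → ∃[ y ] y ∈ˡ ys × R x y) →
  (∀ {x x′ y} → x ∈ˡ xs → x′ ∈ˡ xs → R x y → R x′ y → x ≡ x′) →
  length xs ℕ.≤ length ys
length-≤-by-relation R {xs} {ys} uniq total inj = injective⇒≤ image-injective
  where
  partner : ∀ i → ∃[ y ] y ∈ˡ ys × R (lookup xs i) y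
  partner i = total (∈-lookup i)

  image : Fin (length xs) → Fin (length ys)
  image i = Any.index (proj₁ (proj₂ (partner i)))

  image-injective : ∀ {i j} → image i ≡ image j → i ≡ j
  image-injective {i} {j} eq with partner i | partner j
  ... | y , y∈ , Riy | z , z∈ , Rjz = lookup-injective uniq i j
    (inj (∈-lookup i) (∈-lookup j) Riy (subst (R _) (sym y≡z) Rjz))
    where
    y≡z : y ≡ z
    y≡z = trans (lookup-index y∈) (trans (cong (lookup ys) eq) (sym (lookup-index z∈)))

length-≡-by-relation :
  (R : A → B → Set) {xs : List A} {ys : List B} → Unique xs → Unique ys →
  (∀ {x} → x ∈ˡ xs → ∃[ y ] y ∈ˡ ys × R x y) →
  (∀ {y} → y ∈ˡ ys → ∃[ x ] x ∈ˡ xs × R x y) →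
  (∀ {x x′ y} → x ∈ˡ xs → x′ ∈ˡ xs → R x y → R x′ y → x ≡ x′) →
  (∀ {x y y′} → y ∈ˡ ys → y′ ∈ˡ ys → R x y → R x y′ → y ≡ y′) →
  length xs ≡ length ys
length-≡-by-relation R uxs uys l r li ri = ℕ.≤-antisym
  (length-≤-by-relation R uxs l li)
  (length-≤-by-relation (λ y x → R x y) uys r ri)

AllPairs-from-≢ : {R : A → A → Set} {xs : List A} → Unique xs →
  (∀ {x y} → x ∈ˡ xs → y ∈ˡ xs → x ≢ y → R x y) → AllPairs R xs
AllPairs-from-≢ []         _ = []
AllPairs-from-≢ (x∉ ∷ uniq) f =
  All.tabulate (λ y∈ → f (here refl) (there y∈) (All.lookup x∉ y∈)) ∷
  AllPairs-from-≢ uniq (λ x∈ y∈ → f (there x∈) (there y∈))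

-- Sublists as finite sets

∈-sublists⇒⊆ : ∀ {xs ys : List A} → ys ∈ˡ sublists xs → ∀ {x} → x ∈ˡ ys → x ∈ˡ xs
∈-sublists⇒⊆ {xs = []}     (here refl) ()
∈-sublists⇒⊆ {xs = x ∷ xs} p y∈ with ∈-++⁻ (map (x ∷_) (sublists xs)) p
... | inj₂ q = there (∈-sublists⇒⊆ q y∈)
... | inj₁ q with ∈-map⁻ (x ∷_) q
...   | zs , zs∈ , refl with y∈
...     | here eq = here eq
...     | there z∈ = there (∈-sublists⇒⊆ zs∈ z∈)

∈-sublists⇒Unique : ∀ {xs ys : List A} → Unique xs → ys ∈ˡ sublists xs → Unique ys
∈-sublists⇒Unique {xs = []}     _ (here refl) = []
∈-sublists⇒Unique {xs = x ∷ xs} (x∉ ∷ uniq) p with ∈-++⁻ (map (x ∷_) (sublists xs)) p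
... | inj₂ q = ∈-sublists⇒Unique uniq q
... | inj₁ q with ∈-map⁻ (x ∷_) q
...   | zs , zs∈ , refl =
  All.tabulate (λ z∈ → All.lookup x∉ (∈-sublists⇒⊆ zs∈ z∈)) ∷ ∈-sublists⇒Unique uniq zs∈

filter-∈-sublists : {Q : A → Set} (Q? : Decidable Q) (xs : List A) → filter Q? xs ∈ˡ sublists xs
filter-∈-sublists Q? []       = here refl
filter-∈-sublists Q? (x ∷ xs) with does (Q? x)
... | true  = ∈-++⁺ˡ (∈-map⁺ (x ∷_) (filter-∈-sublists Q? xs))
... | false = ∈-++⁺ʳ (map (x ∷_) (sublists xs)) (filter-∈-sublists Q? xs)

-- Both lists inherit the order of `xs`, so only the choice at each `x` matters; differing choices
-- would put `x` into the rest of `xs`, which excludes it. Partitions can thus be compared by their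
-- parts alone.
sublists-ext : ∀ {xs ys zs : List A} → Unique xs → ys ∈ˡ sublists xs → zs ∈ˡ sublists xs →
  (∀ {x} → x ∈ˡ ys → x ∈ˡ zs) → (∀ {x} → x ∈ˡ zs → x ∈ˡ ys) → ys ≡ zs
sublists-ext {xs = []} _ (here refl) (here refl) _ _ = refl
sublists-ext {xs = x ∷ xs} (x∉ ∷ uniq) p q f g
  with ∈-++⁻ (map (x ∷_) (sublists xs)) p | ∈-++⁻ (map (x ∷_) (sublists xs)) q
... | inj₂ p′ | inj₂ q′ = sublists-ext uniq p′ q′ f g
... | inj₁ p′ | inj₂ q′ with ∈-map⁻ (x ∷_) p′
...   | _ , _ , refl = contradiction refl (All.lookup x∉ (∈-sublists⇒⊆ q′ (f (here refl))))
sublists-ext {xs = x ∷ xs} (x∉ ∷ uniq) p q f g | inj₂ p′ | inj₁ q′ with ∈-map⁻ (x ∷_) q′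
...   | _ , _ , refl = contradiction refl (All.lookup x∉ (∈-sublists⇒⊆ p′ (g (here refl))))
sublists-ext {xs = x ∷ xs} (x∉ ∷ uniq) p q f g | inj₁ p′ | inj₁ q′
  with ∈-map⁻ (x ∷_) p′ | ∈-map⁻ (x ∷_) q′
...   | ys , ys∈ , refl | zs , zs∈ , refl =
  cong (x ∷_) (sublists-ext uniq ys∈ zs∈ (drop ys∈ f) (drop zs∈ g))
  where
  drop : ∀ {us vs} → us ∈ˡ sublists xs → (∀ {y} → y ∈ˡ x ∷ us → y ∈ˡ x ∷ vs) →
         ∀ {y} → y ∈ˡ us → y ∈ˡ vs
  drop us∈ h y∈ with h (there y∈)
  ... | here refl = contradiction refl (All.lookup x∉ (∈-sublists⇒⊆ us∈ y∈))
  ... | there y∈′ = y∈′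

sublists-unique : ∀ {xs : List A} → Unique xs → Unique (sublists xs)
sublists-unique []                      = [] ∷ []
sublists-unique {xs = x ∷ xs} (x∉ ∷ uniq) =
  Unique.++⁺ (Unique.map⁺ (λ { refl → refl }) (sublists-unique uniq)) (sublists-unique uniq)
    λ (p , q) → case ∈-map⁻ (x ∷_) p of λ where
      (_ , _ , refl) → contradiction refl (All.lookup x∉ (∈-sublists⇒⊆ q (here refl)))

-- Finite subsets and their elements

∈-subsets : (S : Subset n) → S ∈ˡ subsets n
∈-subsets []ᵛ       = here refl
∈-subsets (true  ∷ᵛ S) = ∈-cartesianProductWith⁺ _∷ᵛ_ {xs = true ∷ false ∷ []} (here refl) (∈-subsets S)
∈-subsets (false ∷ᵛ S) = ∈-cartesianProductWith⁺ _∷ᵛ_ {xs = true ∷ false ∷ []} (there (here refl)) (∈-subsets S)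

subsets-unique : ∀ n → Unique (subsets n)
subsets-unique ℕ.zero    = [] ∷ []
subsets-unique (ℕ.suc n) = Unique.cartesianProductWith⁺ _∷ᵛ_ ∷-injective
  (((λ ()) ∷ []) ∷ [] ∷ []) (subsets-unique n)

elements : Subset n → List (Fin n)
elements []ᵛ           = []
elements (true  ∷ᵛ S) = zero ∷ map suc (elements S)
elements (false ∷ᵛ S) = map suc (elements S)

length-elements : (S : Subset n) → length (elements S) ≡ ∣ S ∣
length-elements []ᵛ           = refl
length-elements (true  ∷ᵛ S) = cong ℕ.suc (trans (length-map suc (elements S)) (length-elements S))
length-elements (false ∷ᵛ S) = trans (length-map suc (elements S)) (length-elements S)

∈-elements⁺ : ∀ {S : Subset n} {v} → v ∈ S → v ∈ˡ elements S
∈-elements⁺ {S = true  ∷ᵛ S} here       = here refl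
∈-elements⁺ {S = true  ∷ᵛ S} (there v∈) = there (∈-map⁺ suc (∈-elements⁺ v∈))
∈-elements⁺ {S = false ∷ᵛ S} (there v∈) = ∈-map⁺ suc (∈-elements⁺ v∈)

∈-elements⁻ : ∀ {S : Subset n} {v} → v ∈ˡ elements S → v ∈ S
∈-elements⁻ {S = true ∷ᵛ S} (here refl) = here
∈-elements⁻ {S = true ∷ᵛ S} (there v∈) with ∈-map⁻ suc v∈
... | _ , w∈ , refl = there (∈-elements⁻ w∈)
∈-elements⁻ {S = false ∷ᵛ S} v∈ with ∈-map⁻ suc v∈
... | _ , w∈ , refl = there (∈-elements⁻ w∈)

elements-unique : (S : Subset n) → Unique (elements S)
elements-unique []ᵛ           = []
elements-unique (true  ∷ᵛ S) =
  All.tabulate (λ v∈ → λ { refl → case ∈-map⁻ suc v∈ of λ { (_ , _ , ()) } }) ∷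
  Unique.map⁺ suc-injective (elements-unique S)
elements-unique (false ∷ᵛ S) = Unique.map⁺ suc-injective (elements-unique S)

⟦_⟧ : {Q : Fin n → Set} → Decidable Q → Subset n
⟦ Q? ⟧ = tabulate (λ v → does (Q? v))

∈⟦⟧⁺ : {Q : Fin n → Set} (Q? : Decidable Q) → ∀ {v} → Q v → v ∈ ⟦ Q? ⟧
∈⟦⟧⁺ Q? {v} q = lookup⇒[]= v _ (trans (lookup∘tabulate _ v) (dec-true (Q? v) q))

∈⟦⟧⁻ : {Q : Fin n → Set} (Q? : Decidable Q) → ∀ {v} → v ∈ ⟦ Q? ⟧ → Q v
∈⟦⟧⁻ Q? {v} v∈ with Q? v | trans (sym (lookup∘tabulate _ v)) ([]=⇒lookup v∈)
... | yes q | _ = q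
... | no _  | ()

∈⋃⁺ : ∀ {P : List (Subset n)} {v} → Any (v ∈_) P → v ∈ ⋃ P
∈⋃⁺ (here v∈)  = x∈p∪q⁺ (inj₁ v∈)
∈⋃⁺ (there v∈) = x∈p∪q⁺ (inj₂ (∈⋃⁺ v∈))

∈⋃⁻ : ∀ (P : List (Subset n)) {v} → v ∈ ⋃ P → Any (v ∈_) P
∈⋃⁻ []      v∈ = ⊥-elim (∉⊥ v∈)
∈⋃⁻ (T ∷ P) v∈ with x∈p∪q⁻ T (⋃ P) v∈
... | inj₁ v∈T = here v∈T
... | inj₂ v∈P = there (∈⋃⁻ P v∈P)

least : {Q : Fin n → Set} → Decidable Q → ∀ v → Q v → ∃[ u ] Q u × (∀ w → Q w → u ≤ w)
least {n = ℕ.suc _} Q? zero    q = zero , q , λ _ _ → ℕ.z≤n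
least {n = ℕ.suc _} Q? (suc v) q with Q? zero | least (Q? ∘ suc) v q
... | yes q₀ | _            = zero , q₀ , λ _ _ → ℕ.z≤n
... | no ¬q₀ | u , qu , min = suc u , qu , λ where
  zero    q₀ → contradiction q₀ ¬q₀
  (suc w) qw → ℕ.s≤s (min w qw)

-- Clique partitions and root maps

SamePart : List (Subset n) → Fin n → Fin n → Set
SamePart P u v = Any (λ T → u ∈ T × v ∈ T) P

-- Idempotence puts `r v` into the fibre of `v`, and deflation makes it a lower bound of that fibre,
-- so `r` sends each vertex to the least vertex of its clique. This is the middle term between
-- partitions and edge sets.
record IsRootMap (G : Graph n) (r : Fin n → Fin n) : Set where
  open Graph G
  field
    deflationary : ∀ v → r v ≤ v
    idempotent   : ∀ v → r (r v) ≡ r v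
    fibre-clique : ∀ {u v} → r u ≡ r v → u ≢ v → u ∼ v

fixed? : (r : Fin n → Fin n) → Decidable (λ v → r v ≡ v)
fixed? r v = r v ≟ v

fixedPoints : (Fin n → Fin n) → Subset n
fixedPoints r = ⟦ fixed? r ⟧

module _ (G : Graph n) where
  open Graph G

  PartitionHasRoots : List (Subset n) → (Fin n → Fin n) → Set
  PartitionHasRoots P r = ∀ u v → SamePart P u v ⇔ r u ≡ r v

  module _ {P : List (Subset n)} (part : IsCliquePartition G P) where
    private
      nonempty = proj₁ part
      disjoint = proj₁ (proj₂ part)
      covering = proj₁ (proj₂ (proj₂ part))
      cliques  = proj₂ (proj₂ (proj₂ part))

    part-unique : ∀ {S T v} → S ∈ˡ P → T ∈ˡ P → v ∈ S → v ∈ T → S ≡ T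
    part-unique S∈ T∈ v∈S v∈T with ∈-AllPairs₂ disjoint S∈ T∈
    ... | inj₁ S≡T        = S≡T
    ... | inj₂ (inj₁ S∩T) = contradiction (_ , x∈p∩q⁺ (v∈S , v∈T)) S∩T
    ... | inj₂ (inj₂ T∩S) = contradiction (_ , x∈p∩q⁺ (v∈T , v∈S)) T∩S

    samePart-refl : ∀ v → SamePart P v v
    samePart-refl v = Any.map (λ v∈ → v∈ , v∈) (∈⋃⁻ P (subst (v ∈_) (sym covering) ∈⊤))

    samePart-sym : ∀ {u v} → SamePart P u v → SamePart P v u
    samePart-sym = Any.map λ (p , q) → q , p

    samePart-part : ∀ {u v T} → T ∈ˡ P → u ∈ T → SamePart P u v → v ∈ T
    samePart-part T∈ u∈T same with find same
    ... | S , S∈ , u∈S , v∈S = subst (_ ∈_) (part-unique S∈ T∈ u∈S u∈T) v∈S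

    samePart-trans : ∀ {u v w} → SamePart P u v → SamePart P v w → SamePart P u w
    samePart-trans same same′ with find same
    ... | S , S∈ , u∈S , v∈S = lose S∈ (u∈S , samePart-part S∈ v∈S same′)

    samePart? : ∀ u v → Dec (SamePart P u v)
    samePart? u v = Any.any? (λ T → (u ∈? T) ×-dec (v ∈? T)) P

    -- The root of a vertex is the least vertex of its part. Vertices of one part minimise over the
    -- same set, so antisymmetry identifies their roots; conversely each vertex shares a part with
    -- its root.
    partition⇒rootMap : ∃[ r ] IsRootMap G r × PartitionHasRoots P r
    partition⇒rootMap = r , isRootMap , λ u v → mk⇔ same⇒≡ ≡⇒same
      where
      leastInPart : ∀ v → ∃[ u ] SamePart P u v × (∀ w → SamePart P w v → u ≤ w)
      leastInPart v = least (λ u → samePart? u v) v (samePart-refl v)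

      r : Fin n → Fin n
      r v = proj₁ (leastInPart v)

      r-same : ∀ v → SamePart P (r v) v
      r-same v = proj₁ (proj₂ (leastInPart v))

      r-least : ∀ {w} v → SamePart P w v → r v ≤ w
      r-least v = proj₂ (proj₂ (leastInPart v)) _

      same⇒≡ : ∀ {u v} → SamePart P u v → r u ≡ r v
      same⇒≡ {u} {v} same = ≤ᶠ-antisym
        (r-least u (samePart-trans (r-same v) (samePart-sym same)))
        (r-least v (samePart-trans (r-same u) same))

      ≡⇒same : ∀ {u v} → r u ≡ r v → SamePart P u v
      ≡⇒same {u} {v} eq = samePart-trans (samePart-sym (r-same u))
        (subst (λ w → SamePart P w v) (sym eq) (r-same v))

      isRootMap : IsRootMap G r
      isRootMap = record
        { deflationary = λ v → r-least v (samePart-refl v)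
        ; idempotent   = λ v → same⇒≡ (r-same v)
        ; fibre-clique = λ eq u≢v → case find (≡⇒same eq) of λ
            (T , T∈ , u∈ , v∈) → All.lookup cliques T∈ _ _ u∈ v∈ u≢v
        }

    -- Each part contains exactly one fixed point, the common root of its members. `Unique P` makes
    -- the length count distinct parts.
    length-partition : ∀ {r} → Unique P → IsRootMap G r → PartitionHasRoots P r →
      length P ≡ ∣ fixedPoints r ∣
    length-partition {r} uniq isRoot P~r = trans
      (length-≡-by-relation (λ T v → T ∈ˡ P × v ∈ T) uniq (elements-unique (fixedPoints r))
        root-of-part part-of-root
        (λ _ _ (T∈ , v∈T) (T′∈ , v∈T′) → part-unique T∈ T′∈ v∈T v∈T′)
        (λ {T} {v} {v′} v∈ v′∈ (T∈ , v∈T) (_ , v′∈T) → trans (sym (fixed v∈))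
          (trans (to (P~r v v′) (lose T∈ (v∈T , v′∈T))) (fixed v′∈))))
      (length-elements (fixedPoints r))
      where
      open IsRootMap isRoot
      fixed : ∀ {v} → v ∈ˡ elements (fixedPoints r) → r v ≡ v
      fixed v∈ = ∈⟦⟧⁻ (fixed? r) (∈-elements⁻ v∈)

      root-of-part : ∀ {T} → T ∈ˡ P → ∃[ v ] v ∈ˡ elements (fixedPoints r) × T ∈ˡ P × v ∈ T
      root-of-part T∈ with All.lookup nonempty T∈
      ... | u , u∈T = r u , ∈-elements⁺ (∈⟦⟧⁺ (fixed? r) (idempotent u)) , T∈ ,
        samePart-part T∈ u∈T (from (P~r u (r u)) (sym (idempotent u)))

      part-of-root : ∀ {v} → v ∈ˡ elements (fixedPoints r) → ∃[ T ] T ∈ˡ P × T ∈ˡ P × v ∈ T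
      part-of-root {v} _ with find (samePart-refl v)
      ... | T , T∈ , v∈T , _ = T , T∈ , T∈ , v∈T

  -- By idempotence `r′ v` lies in the part of `v`, so `r v` equals `r (r′ v)`, which is at most
  -- `r′ v`; exchanging the maps gives the other inequality.
  rootMap-unique : ∀ {P r r′} → IsRootMap G r → IsRootMap G r′ →
    PartitionHasRoots P r → PartitionHasRoots P r′ → ∀ v → r v ≡ r′ v
  rootMap-unique {P} isRoot isRoot′ P~r P~r′ v =
    ≤ᶠ-antisym (below isRoot isRoot′ P~r P~r′) (below isRoot′ isRoot P~r′ P~r)
    where
    below : ∀ {r r′} → IsRootMap G r → IsRootMap G r′ →
      PartitionHasRoots P r → PartitionHasRoots P r′ → r v ≤ r′ v
    below {r} {r′} isRoot isRoot′ P~r P~r′ = subst (_≤ r′ v)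
      (to (P~r (r′ v) v) (from (P~r′ (r′ v) v) (IsRootMap.idempotent isRoot′ v)))
      (IsRootMap.deflationary isRoot (r′ v))

  partition-⊆ : ∀ {P P′ r} → IsCliquePartition G P → IsCliquePartition G P′ →
    PartitionHasRoots P r → PartitionHasRoots P′ r → ∀ {T} → T ∈ˡ P → T ∈ˡ P′
  partition-⊆ part part′ P~r P′~r {T} T∈ with All.lookup (proj₁ part) T∈
  ... | v , v∈T with find (samePart-refl part′ v)
  ...   | T′ , T′∈ , v∈T′ , _ = subst (_∈ˡ _) (⊆-antisym
    (λ {w} w∈T′ → samePart-part part T∈ v∈T (from (P~r v w) (to (P′~r v w) (lose T′∈ (v∈T′ , w∈T′)))))
    (λ {w} w∈T → samePart-part part′ T′∈ v∈T′ (from (P′~r v w) (to (P~r v w) (lose T∈ (v∈T , w∈T))))))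
    T′∈

  partition-unique : ∀ {P P′ r} → P ∈ˡ sublists (subsets n) → P′ ∈ˡ sublists (subsets n) →
    IsCliquePartition G P → IsCliquePartition G P′ →
    PartitionHasRoots P r → PartitionHasRoots P′ r → P ≡ P′
  partition-unique P∈ P′∈ part part′ P~r P′~r = sublists-ext (subsets-unique n) P∈ P′∈
    (partition-⊆ part part′ P~r P′~r) (partition-⊆ part′ part P′~r P~r)

  -- The partition into fibres of a root map

  module _ {r : Fin n → Fin n} (isRoot : IsRootMap G r) where
    open IsRootMap isRoot

    private
      inFibre? : ∀ w → Decidable (λ v → r v ≡ r w)
      inFibre? w v = r v ≟ r w

      fibre : Fin n → Subset n
      fibre w = ⟦ inFibre? w ⟧

      IsFibre : Subset n → Set
      IsFibre T = ∃[ w ] T ≡ fibre w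

      isFibre? : Decidable IsFibre
      isFibre? T = any? λ w → ≡-dec Bool._≟_ T (fibre w)

      -- Filtering `subsets n`, instead of mapping `fibre` over the vertices, lists a fibre once
      -- however many members it has, and yields a sublist as the counting requires.
      fibres : List (Subset n)
      fibres = filter isFibre? (subsets n)

      fibre∈ : ∀ w → fibre w ∈ˡ fibres
      fibre∈ w = ∈-filter⁺ isFibre? (∈-subsets (fibre w)) (w , refl)

      isFibre : ∀ {T} → T ∈ˡ fibres → IsFibre T
      isFibre T∈ = proj₂ (∈-filter⁻ isFibre? {xs = subsets n} T∈)

      fibre-refl : ∀ v → v ∈ fibre v
      fibre-refl v = ∈⟦⟧⁺ (inFibre? v) refl

      sameFibre : ∀ {u v T} → T ∈ˡ fibres → u ∈ T → v ∈ T → r u ≡ r v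
      sameFibre T∈ u∈ v∈ with isFibre T∈
      ... | w , refl = trans (∈⟦⟧⁻ (inFibre? w) u∈) (sym (∈⟦⟧⁻ (inFibre? w) v∈))

      fibre-≡ : ∀ {v T} → T ∈ˡ fibres → v ∈ T → T ≡ fibre v
      fibre-≡ {v} T∈ v∈ with isFibre T∈
      ... | w , refl = ⊆-antisym
        (λ u∈ → ∈⟦⟧⁺ (inFibre? v) (sameFibre T∈ u∈ v∈))
        (λ u∈ → ∈⟦⟧⁺ (inFibre? w) (trans (∈⟦⟧⁻ (inFibre? v) u∈) (∈⟦⟧⁻ (inFibre? w) v∈)))

    rootMap⇒partition :
      ∃[ P ] P ∈ˡ sublists (subsets n) × IsCliquePartition G P × PartitionHasRoots P r
    rootMap⇒partition = fibres , filter-∈-sublists isFibre? (subsets n) ,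
      ( All.tabulate (λ T∈ → case isFibre T∈ of λ { (w , refl) → w , fibre-refl w })
      , AllPairs-from-≢ (Unique.filter⁺ isFibre? (subsets-unique n))
          (λ {S} {T} S∈ T∈ S≢T (v , v∈) → case x∈p∩q⁻ S T v∈ of λ
            (v∈S , v∈T) → S≢T (trans (fibre-≡ S∈ v∈S) (sym (fibre-≡ T∈ v∈T))))
      , ⊆-antisym ⊆⊤ (λ {v} _ → ∈⋃⁺ (lose (fibre∈ v) (fibre-refl v)))
      , All.tabulate (λ T∈ u v u∈ v∈ → fibre-clique (sameFibre T∈ u∈ v∈))
      ) ,
      λ u v → mk⇔
        (λ same → case find same of λ (T , T∈ , u∈ , v∈) → sameFibre T∈ u∈ v∈)
        (λ eq → lose (fibre∈ v) (∈⟦⟧⁺ (inFibre? v) eq , fibre-refl v))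

  -- Edges and their conflicts

  IsEdge : Fin n × Fin n → Set
  IsEdge (i , j) = i < j × i ∼ j

  isEdge? : Decidable IsEdge
  isEdge? (i , j) = (i <? j) ×-dec (i ∼? j)

  edges : List (Fin n × Fin n)
  edges = filter isEdge? (cartesianProduct (allFin n) (allFin n))

  edges-unique : Unique edges
  edges-unique = Unique.filter⁺ isEdge?
    (Unique.cartesianProduct⁺ (Unique.allFin⁺ n) (Unique.allFin⁺ n))

  Edge : Set
  Edge = Fin (length edges)

  lower upper : Edge → Fin n
  lower e = proj₁ (lookup edges e)
  upper e = proj₂ (lookup edges e)

  edge-isEdge : ∀ e → IsEdge (lookup edges e)
  edge-isEdge e = proj₂
    (∈-filter⁻ isEdge? {xs = cartesianProduct (allFin n) (allFin n)} (∈-lookup e))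

  lower<upper : ∀ e → lower e < upper e
  lower<upper e = proj₁ (edge-isEdge e)

  lower∼upper : ∀ e → lower e ∼ upper e
  lower∼upper e = proj₂ (edge-isEdge e)

  lower≢upper : ∀ e → lower e ≢ upper e
  lower≢upper e = <ᶠ⇒≢ (lower<upper e)

  edge-injective : ∀ {e f} → lower e ≡ lower f → upper e ≡ upper f → e ≡ f
  edge-injective p q = lookup-injective edges-unique _ _ (cong₂ _,_ p q)

  edge-between : ∀ {i j} → i < j → i ∼ j → ∃[ e ] lower e ≡ i × upper e ≡ j
  edge-between {i} {j} i<j i∼j = Any.index ij∈ ,
    cong proj₁ (sym (lookup-index ij∈)) , cong proj₂ (sym (lookup-index ij∈))
    where
    ij∈ : (i , j) ∈ˡ edges
    ij∈ = ∈-filter⁺ isEdge? (∈-cartesianProduct⁺ (∈-allFin i) (∈-allFin j)) (i<j , i∼j)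

  -- For distinct edges the alternatives are the obstructions to a common root map: a vertex with
  -- two roots, a root that is itself moved (either way round), and non-adjacent vertices in one
  -- fibre.
  Conflict : Edge → Edge → Set
  Conflict e f = upper e ≡ upper f ⊎ upper e ≡ lower f ⊎ lower e ≡ upper f ⊎
                 (lower e ≡ lower f × ¬ (upper e ∼ upper f))

  conflict? : ∀ e f → Dec (Conflict e f)
  conflict? e f = (upper e ≟ upper f) ⊎-dec (upper e ≟ lower f) ⊎-dec (lower e ≟ upper f) ⊎-dec
                  ((lower e ≟ lower f) ×-dec ¬? (upper e ∼? upper f))

  conflict-sym : ∀ {e f} → Conflict e f → Conflict f e
  conflict-sym (inj₁ p)                      = inj₁ (sym p)
  conflict-sym (inj₂ (inj₁ p))               = inj₂ (inj₂ (inj₁ (sym p)))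
  conflict-sym (inj₂ (inj₂ (inj₁ p)))        = inj₂ (inj₁ (sym p))
  conflict-sym (inj₂ (inj₂ (inj₂ (p , ¬q)))) = inj₂ (inj₂ (inj₂ (sym p , ¬q ∘ ∼-sym)))

  conflictGraph : Graph (length edges)
  conflictGraph = record
    -- Each edge meets the first alternative against itself, so `e ≢ f` is what excludes loops.
    { _∼_      = λ e f → e ≢ f × Conflict e f
    ; _∼?_     = λ e f → ¬? (e ≟ f) ×-dec conflict? e f
    ; ∼-sym    = λ (e≢f , c) → e≢f ∘ sym , conflict-sym c
    ; ∼-irrefl = λ _ (e≢e , _) → e≢e refl
    }

  -- For a root map `r`, `S` is the graph of `r` away from its fixed points.
  EdgesJoinRoots : Subset (length edges) → (Fin n → Fin n) → Set
  EdgesJoinRoots S r = ∀ e → e ∈ S ⇔ r (upper e) ≡ lower e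

  -- Independent sets and root maps

  module _ {S : Subset (length edges)} (indep : IsIndependent conflictGraph S) where

    conflict⇒≡ : ∀ {e f} → e ∈ S → f ∈ S → Conflict e f → e ≡ f
    conflict⇒≡ {e} {f} e∈ f∈ c = decidable-stable (e ≟ f) λ e≢f → indep e f e∈ f∈ (e≢f , c)

    -- `r` sends the upper end of each edge in `S` to its lower end and fixes all other vertices.
    -- The absence of conflicts yields that the lower end is unique, that `r` is idempotent and that
    -- fibres are cliques.
    independent⇒rootMap : ∃[ r ] IsRootMap G r × EdgesJoinRoots S r
    independent⇒rootMap = r , isRootMap , λ e → mk⇔ ∈⇒root root⇒∈
      where
      -- Records why `w` is the value at `v`; with the equations as arguments, matching need not
      -- unify with the computed value of `r`.
      data RootOf (v w : Fin n) : Set where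
        child : ∀ e → e ∈ S → upper e ≡ v → lower e ≡ w → RootOf v w
        root  : (∀ e → e ∈ S → upper e ≢ v) → v ≡ w → RootOf v w

      rootOf : ∀ v → ∃ (RootOf v)
      rootOf v with any? (λ e → (e ∈? S) ×-dec (upper e ≟ v))
      ... | yes (e , e∈ , eq) = lower e , child e e∈ eq refl
      ... | no  ¬e            = v , root (λ e e∈ eq → ¬e (e , e∈ , eq)) refl

      r : Fin n → Fin n
      r v = proj₁ (rootOf v)

      r-root : ∀ v → RootOf v (r v)
      r-root v = proj₂ (rootOf v)

      ∈⇒root : ∀ {e} → e ∈ S → r (upper e) ≡ lower e
      ∈⇒root {e} e∈ with r-root (upper e)
      ... | child f f∈ up lo = trans (sym lo) (cong lower (conflict⇒≡ f∈ e∈ (inj₁ up)))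
      ... | root none _      = contradiction refl (none e e∈)

      root⇒∈ : ∀ {e} → r (upper e) ≡ lower e → e ∈ S
      root⇒∈ {e} eq with r-root (upper e)
      ... | child f f∈ up lo = subst (_∈ S) (edge-injective (trans lo eq) up) f∈
      ... | root _ fix       = contradiction (sym (trans fix eq)) (lower≢upper e)

      isRootMap : IsRootMap G r
      isRootMap = record { deflationary = defl ; idempotent = idem ; fibre-clique = clique }
        where
        defl : ∀ v → r v ≤ v
        defl v with r-root v
        ... | child e _ up lo = subst₂ _≤_ lo up (ℕ.<⇒≤ (lower<upper e))
        ... | root _ fix      = subst (_≤ v) fix ≤ᶠ-refl

        idem : ∀ v → r (r v) ≡ r v
        idem v with r-root (r v)
        ... | root _ fix = sym fix
        -- Here `r v` is the upper end of some `e` in `S`. If `v` is a root, `v` itself would be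
        -- that upper end. Otherwise `r v` is the lower end of an `f` in `S`; the conflict makes `e`
        -- and `f` one edge, whose ends would be equal.
        ... | child e e∈ up _ with r-root v
        ...   | root none fix    = contradiction (trans up (sym fix)) (none e e∈)
        ...   | child f f∈ _ lo′
              with refl ← conflict⇒≡ e∈ f∈ (inj₂ (inj₁ (trans up (sym lo′))))
              = contradiction (trans lo′ (sym up)) (lower≢upper e)

        clique : ∀ {u v} → r u ≡ r v → u ≢ v → u ∼ v
        clique {u} {v} eq u≢v with r-root u | r-root v
        ... | root _ fix | root _ fix′ = contradiction (trans fix (trans eq (sym fix′))) u≢v
        -- `u` is the root of `v`, so the edge `f` itself joins them.
        ... | root _ fix | child f _ up lo =
          subst₂ _∼_ (trans lo (sym (trans fix eq))) up (lower∼upper f)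
        ... | child e _ up lo | root _ fix =
          ∼-sym (subst₂ _∼_ (trans lo (trans eq (sym fix))) up (lower∼upper e))
        -- Both edges have the same lower end, so non-adjacency of `u` and `v` would be a conflict
        -- of the last kind, forcing `e ≡ f` and hence `u ≡ v`.
        ... | child e e∈ up lo | child f f∈ up′ lo′ =
          decidable-stable (u ∼? v) λ u≁v → u≢v (trans (sym up) (trans (cong upper
            (conflict⇒≡ e∈ f∈ (inj₂ (inj₂ (inj₂
              (trans lo (trans eq (sym lo′)) , u≁v ∘ subst₂ _∼_ up up′)))))) up′))

  module _ {r : Fin n → Fin n} (isRoot : IsRootMap G r) where
    open IsRootMap isRoot

    -- `r v` and `v` lie in one fibre by idempotence, hence are adjacent; deflation gives the
    -- orientation.
    root-edge : ∀ {v} → r v ≢ v → ∃[ e ] lower e ≡ r v × upper e ≡ v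
    root-edge {v} r≢ = edge-between (≤∧≢⇒<ᶠ (deflationary v) r≢) (fibre-clique (idempotent v) r≢)

    rootMap⇒independent : ∃[ S ] IsIndependent conflictGraph S × EdgesJoinRoots S r
    rootMap⇒independent = ⟦ joinsRoot? ⟧ , independent ,
      λ e → mk⇔ (∈⟦⟧⁻ joinsRoot?) (∈⟦⟧⁺ joinsRoot?)
      where
      joinsRoot? : Decidable (λ e → r (upper e) ≡ lower e)
      joinsRoot? e = r (upper e) ≟ lower e

      lower-fixed : ∀ {e} → r (upper e) ≡ lower e → r (lower e) ≡ lower e
      lower-fixed {e} p = trans (cong r (sym p)) (trans (idempotent (upper e)) p)

      -- Lower ends of chosen edges are fixed by `r`, upper ends are moved.
      upper≢lower : ∀ {e f} → r (upper e) ≡ lower e → r (upper f) ≡ lower f → upper e ≢ lower f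
      upper≢lower {e} {f} p q eq = lower≢upper e
        (trans (sym p) (trans (cong r eq) (trans (lower-fixed q) (sym eq))))

      independent : IsIndependent conflictGraph ⟦ joinsRoot? ⟧
      independent e f e∈ f∈ (e≢f , c) = absurd c
        where
        p = ∈⟦⟧⁻ joinsRoot? e∈
        q = ∈⟦⟧⁻ joinsRoot? f∈
        absurd : ¬ Conflict e f
        absurd (inj₁ up) = e≢f (edge-injective (trans (sym p) (trans (cong r up) q)) up)
        absurd (inj₂ (inj₁ eq)) = upper≢lower p q eq
        absurd (inj₂ (inj₂ (inj₁ eq))) = upper≢lower q p (sym eq)
        -- A common lower end puts the upper ends in one fibre; they differ because an edge is
        -- determined by its ends.
        absurd (inj₂ (inj₂ (inj₂ (lo , ≁)))) =
          ≁ (fibre-clique (trans p (trans lo (sym q))) (e≢f ∘ edge-injective lo))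

    -- `upper` matches `S` with the vertices moved by `r`: each of them is joined to its root by
    -- exactly one edge of `S`.
    card-edges : ∀ {S} → EdgesJoinRoots S r → ∣ S ∣ ≡ n ℕ.∸ ∣ fixedPoints r ∣
    card-edges {S} S~r = trans (sym (length-elements S)) (trans
      (length-≡-by-relation (λ e v → upper e ≡ v) (elements-unique S) (elements-unique moved)
        (λ {e} e∈ → upper e ,
          ∈-elements⁺ (x∉p⇒x∈∁p λ v∈ → lower≢upper e
            (trans (sym (to (S~r e) (∈-elements⁻ e∈))) (∈⟦⟧⁻ (fixed? r) v∈))) , refl)
        edge-above
        (λ {e} {f} e∈ f∈ p q → edge-injective
          (trans (sym (to (S~r e) (∈-elements⁻ e∈)))
            (trans (cong r (trans p (sym q))) (to (S~r f) (∈-elements⁻ f∈))))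
          (trans p (sym q)))
        (λ _ _ p q → trans (sym p) q))
      (trans (length-elements moved) (∣∁p∣≡n∸∣p∣ (fixedPoints r))))
      where
      moved : Subset n
      moved = ∁ (fixedPoints r)

      edge-above : ∀ {v} → v ∈ˡ elements moved → ∃[ e ] e ∈ˡ elements S × upper e ≡ v
      edge-above v∈ with root-edge (λ fix → x∈∁p⇒x∉p (∈-elements⁻ v∈) (∈⟦⟧⁺ (fixed? r) fix))
      ... | e , lo , up = e , ∈-elements⁺ (from (S~r e) (trans (cong r up) (sym lo))) , up

  -- Uniqueness and the equality of the two counts

  root-transfer : ∀ {S r r′ v} → IsRootMap G r →
    EdgesJoinRoots S r → EdgesJoinRoots S r′ → r v ≢ v → r v ≡ r′ v
  root-transfer isRoot S~r S~r′ ¬fix with root-edge isRoot ¬fix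
  ... | e , lo , refl = trans (sym lo) (sym (to (S~r′ e) (from (S~r e) (sym lo))))

  -- Where one map moves `v`, the edge from the root to `v` lies in `S` and dictates the value of
  -- the other map; elsewhere both fix `v`.
  edges-rootMap-unique : ∀ {S r r′} → IsRootMap G r → IsRootMap G r′ →
    EdgesJoinRoots S r → EdgesJoinRoots S r′ → ∀ v → r v ≡ r′ v
  edges-rootMap-unique {S} {r} {r′} isRoot isRoot′ S~r S~r′ v with r v ≟ v | r′ v ≟ v
  ... | yes p | yes q = trans p (sym q)
  ... | no ¬p | _     = root-transfer isRoot S~r S~r′ ¬p
  ... | yes _ | no ¬q = sym (root-transfer isRoot′ S~r′ S~r ¬q)

  edgeSet-unique : ∀ {S S′ r} → EdgesJoinRoots S r → EdgesJoinRoots S′ r → S ≡ S′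
  edgeSet-unique S~r S′~r = ⊆-antisym
    (λ {e} e∈ → from (S′~r e) (to (S~r e) e∈)) (λ {e} e∈ → from (S~r e) (to (S′~r e) e∈))

  -- The root map determines, and up to pointwise equality is determined by, each side; hence the
  -- relation is one-to-one between clique partitions and independent sets.
  Corresponds : List (Subset n) → Subset (length edges) → Set
  Corresponds P S = ∃[ r ] IsRootMap G r × PartitionHasRoots P r × EdgesJoinRoots S r

  card-corresponds : ∀ {P S} → P ∈ˡ sublists (subsets n) → IsCliquePartition G P →
    Corresponds P S → ∣ S ∣ ≡ n ℕ.∸ length P
  card-corresponds P∈ part (r , isRoot , P~r , S~r) = trans (card-edges isRoot S~r)
    (cong (n ℕ.∸_) (sym (length-partition part
      (∈-sublists⇒Unique (subsets-unique n) P∈) isRoot P~r)))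

  length≤n : ∀ {P} → P ∈ˡ sublists (subsets n) → IsCliquePartition G P → length P ℕ.≤ n
  length≤n P∈ part with partition⇒rootMap part
  ... | r , isRoot , P~r = subst (ℕ._≤ n)
    (sym (length-partition part (∈-sublists⇒Unique (subsets-unique n) P∈) isRoot P~r))
    (∣p∣≤n (fixedPoints r))

  -- `Corresponds` turns length `k` into cardinality `n ∸ k`. The bound matters: for `k > n` the
  -- left count is 0, while `n ∸ k` is 0 and the empty set makes the right count 1.
  cliquePartitionCount≡independentSetCount : ∀ {k} → k ℕ.≤ n →
    cliquePartitionCount G k ≡ independentSetCount conflictGraph (n ℕ.∸ k)
  cliquePartitionCount≡independentSetCount {k} k≤n = length-≡-by-relation Corresponds
    (Unique.filter⁺ cover? (sublists-unique (subsets-unique n)))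
    (Unique.filter⁺ indep? (subsets-unique (length edges)))
    toSet toPartition partition-inj set-inj
    where
    cover? : Decidable (λ P → length P ≡ k × IsCliquePartition G P)
    cover? P = (length P ℕ.≟ k) ×-dec isCliquePartition? G P

    indep? : Decidable (λ S → ∣ S ∣ ≡ n ℕ.∸ k × IsIndependent conflictGraph S)
    indep? S = (∣ S ∣ ℕ.≟ n ℕ.∸ k) ×-dec isIndependent? conflictGraph S

    covers = filter cover? (sublists (subsets n))
    indeps = filter indep? (subsets (length edges))

    ∈covers : ∀ {P} → P ∈ˡ covers →
      P ∈ˡ sublists (subsets n) × length P ≡ k × IsCliquePartition G P
    ∈covers = ∈-filter⁻ cover? {xs = sublists (subsets n)}

    toSet : ∀ {P} → P ∈ˡ covers → ∃[ S ] S ∈ˡ indeps × Corresponds P S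
    toSet P∈ with ∈covers P∈
    ... | P∈′ , len , part with partition⇒rootMap part
    ...   | r , isRoot , P~r with rootMap⇒independent isRoot
    ...     | S , indep , S~r = S , ∈-filter⁺ indep? (∈-subsets S)
      (trans (card-corresponds P∈′ part P~S) (cong (n ℕ.∸_) len) , indep) , P~S
      where P~S = r , isRoot , P~r , S~r

    toPartition : ∀ {S} → S ∈ˡ indeps → ∃[ P ] P ∈ˡ covers × Corresponds P S
    toPartition {S} S∈ with ∈-filter⁻ indep? {xs = subsets (length edges)} S∈
    ... | _ , card , indep with independent⇒rootMap indep
    ...   | r , isRoot , S~r with rootMap⇒partition isRoot
    ...     | P , P∈ , part , P~r = P , ∈-filter⁺ cover? P∈
      -- Truncated subtraction from `n` is injective only on numbers up to `n`, so the length of `P`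
      -- needs its own bound.
      (ℕ.∸-cancelˡ-≡ (length≤n P∈ part) k≤n
        (trans (sym (card-corresponds P∈ part P~S)) card) , part) , P~S
      where P~S = r , isRoot , P~r , S~r

    partition-inj : ∀ {P P′ S} → P ∈ˡ covers → P′ ∈ˡ covers →
      Corresponds P S → Corresponds P′ S → P ≡ P′
    partition-inj P∈ P′∈ (r , isRoot , P~r , S~r) (r′ , isRoot′ , P′~r′ , S~r′)
      with ∈covers P∈ | ∈covers P′∈
    ... | P∈′ , _ , part | P′∈′ , _ , part′ = partition-unique P∈′ P′∈′ part part′ P~r
      -- The two root maps are known to agree only pointwise, so the description of `P′` is
      -- transported at each pair of vertices.
      λ u v → subst₂ (λ a b → SamePart _ u v ⇔ a ≡ b) (sym (r≗r′ u)) (sym (r≗r′ v)) (P′~r′ u v)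
      where r≗r′ = edges-rootMap-unique isRoot isRoot′ S~r S~r′

    set-inj : ∀ {P S S′} → S ∈ˡ indeps → S′ ∈ˡ indeps →
      Corresponds P S → Corresponds P S′ → S ≡ S′
    set-inj _ _ (r , isRoot , P~r , S~r) (r′ , isRoot′ , P~r′ , S′~r′) =
      edgeSet-unique {r = r} S~r λ e →
        subst (λ a → e ∈ _ ⇔ a ≡ lower e) (sym (r≗r′ (upper e))) (S′~r′ e)
      where r≗r′ = rootMap-unique isRoot isRoot′ P~r P~r′

  -- `S` has as many edges as `r` has moved vertices, and the root of any vertex is not moved. For
  -- `n = 0` the bound fails, and so would the polynomial identity in a nontrivial ring: the adjoint
  -- sum is empty but the independence polynomial is 1.
  independent-card<n : .{{_ : NonZero n}} → ∀ {S} → IsIndependent conflictGraph S → ∣ S ∣ ℕ.< n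
  independent-card<n {S} indep with independent⇒rootMap indep
  ... | r , isRoot , S~r = ℕ.≤∧≢⇒< (subst (ℕ._≤ n) (sym card) (∣p∣≤n moved)) λ ∣S∣≡n →
    x∈∁p⇒x∉p (subst (r v₀ ∈_) (sym (∣p∣≡n⇒p≡⊤ (trans (sym card) ∣S∣≡n))) ∈⊤)
      (∈⟦⟧⁺ (fixed? r) (IsRootMap.idempotent isRoot v₀))
    where
    moved = ∁ (fixedPoints r)
    v₀ : Fin n
    v₀ = fromℕ< (ℕ.>-nonZero⁻¹ n)
    card : ∣ S ∣ ≡ ∣ moved ∣
    card = trans (card-edges isRoot S~r) (sym (∣∁p∣≡n∸∣p∣ (fixedPoints r)))

-- The polynomial identity

independentSetCount≡0 : ∀ {m k} (H : Graph m) → (∀ {S} → IsIndependent H S → ∣ S ∣ ≢ k) →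
  independentSetCount H k ≡ 0
independentSetCount≡0 {m} {k} H ≢k = cong length
  (filter-none (λ S → (∣ S ∣ ℕ.≟ k) ×-dec isIndependent? H S) {xs = subsets m}
    (All.tabulate λ _ (eq , indep) → ≢k indep eq))

module _ {c ℓ} (R : CommutativeRing c ℓ) where
  open CommutativeRing R renaming (refl to ≈-refl; sym to ≈-sym; trans to ≈-trans; zero to *-zero)
  open Algebra.Properties.Semiring.Exp semiring using (_^_; ^-congˡ; ^-homo-*)
  open Algebra.Properties.CommutativeSemiring.Exp commutativeSemiring using (^-distrib-*)
  open Algebra.Properties.Semiring.Mult semiring using (×-comm-*; ×-congʳ)
    renaming (_×_ to _·_)
  open Algebra.Properties.Semiring.Sum semiring
    using (sum-syntax; sum⁺-syntax; sum-cong-≋; sum-permute; *-distribˡ-sum; sum-replicate-zero)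
  open Relation.Binary.Reasoning.Setoid setoid

  -- Serves to compare sums over different ranges by padding with zeros. Vanishing at all `j` from
  -- `a` on passes to `f ∘ suc` in the induction.
  ∑-extend : (f : ℕ → Carrier) → ∀ a b → (∀ {j} → a ℕ.≤ j → f j ≈ 0#) →
    ∑[ i < a ℕ.+ b ] f (toℕ i) ≈ ∑[ i < a ] f (toℕ i)
  ∑-extend f ℕ.zero    b f≈0 =
    ≈-trans (sum-cong-≋ {b} (λ _ → f≈0 ℕ.z≤n)) (sum-replicate-zero b)
  ∑-extend f (ℕ.suc a) b f≈0 = +-congˡ (∑-extend (f ∘ ℕ.suc) a b (f≈0 ∘ ℕ.s≤s))

  1^n≈1 : ∀ n → 1# ^ n ≈ 1#
  1^n≈1 ℕ.zero    = ≈-refl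
  1^n≈1 (ℕ.suc n) = ≈-trans (*-identityˡ _) (1^n≈1 n)

  module _ {x x⁻¹ : Carrier} (xx⁻¹≈1 : x * x⁻¹ ≈ 1#) where

    ^-cancel-inverse : ∀ k j → x ^ (k ℕ.+ j) * x⁻¹ ^ j ≈ x ^ k
    ^-cancel-inverse k j = begin
      x ^ (k ℕ.+ j) * x⁻¹ ^ j     ≈⟨ *-congʳ (^-homo-* x k j) ⟩
      x ^ k * x ^ j * x⁻¹ ^ j     ≈⟨ *-assoc _ _ _ ⟩
      x ^ k * (x ^ j * x⁻¹ ^ j)   ≈⟨ *-congˡ (^-distrib-* x x⁻¹ j) ⟨
      x ^ k * (x * x⁻¹) ^ j       ≈⟨ *-congˡ (≈-trans (^-congˡ j xx⁻¹≈1) (1^n≈1 j)) ⟩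
      x ^ k * 1#                  ≈⟨ *-identityʳ _ ⟩
      x ^ k                       ∎

    -- The factor `x ^ n` comes from writing `x ^ k` as `x ^ (k + (n ∸ k)) * x⁻¹ ^ (n ∸ k)`.
    reciprocal-term : ∀ s a {n k} → k ℕ.≤ n →
      s * (a · x ^ k) ≈ x ^ n * (s * (a · x⁻¹ ^ (n ℕ.∸ k)))
    reciprocal-term s a {n} {k} k≤n = begin
      s * (a · x ^ k)
        ≈⟨ *-congˡ (×-congʳ a (^-cancel-inverse k (n ℕ.∸ k))) ⟨
      s * (a · (x ^ (k ℕ.+ (n ℕ.∸ k)) * x⁻¹ ^ (n ℕ.∸ k)))
        ≡⟨ cong (λ m → s * (a · (x ^ m * x⁻¹ ^ (n ℕ.∸ k)))) (ℕ.m+[n∸m]≡n k≤n) ⟩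
      s * (a · (x ^ n * x⁻¹ ^ (n ℕ.∸ k)))
        ≈⟨ *-congˡ (×-comm-* a _ _) ⟨
      s * (x ^ n * (a · x⁻¹ ^ (n ℕ.∸ k)))
        ≈⟨ *-assoc _ _ _ ⟨
      s * x ^ n * (a · x⁻¹ ^ (n ℕ.∸ k))
        ≈⟨ *-congʳ (*-comm _ _) ⟩
      x ^ n * s * (a · x⁻¹ ^ (n ℕ.∸ k))
        ≈⟨ *-assoc _ _ _ ⟩
      x ^ n * (s * (a · x⁻¹ ^ (n ℕ.∸ k)))
        ∎

    adjointPolynomial≈ : ∀ {n} .{{_ : NonZero n}} (G : Graph n) →
      adjointPolynomial R G x ≈ x ^ n * independencePolynomial R (conflictGraph G) x⁻¹
    adjointPolynomial≈ {n} G = begin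
      adjointPolynomial R G x
        ≈⟨ sum-cong-≋ {n} term ⟩
      -- `opposite i` has value `n ∸ suc (toℕ i)`, that is `n ∸ k`: passing from parts to edges
      -- reverses the order of summation.
      ∑[ i < n ] g (toℕ (opposite i))
        ≈⟨ sum-permute (g ∘ toℕ) (reverse {n}) ⟨
      ∑[ i < n ] g (toℕ i)
        -- Either of the ranges `n` and `suc m` may be the longer one, so both are padded to their
        -- sum. Terms from `n` on vanish because independent sets have fewer than `n` elements,
        -- those beyond `m` because `Ĝ` has `m` vertices.
        ≈⟨ ∑-extend g n (ℕ.suc m) (λ n≤j → g≈0 λ indep eq →
             ℕ.<⇒≱ (independent-card<n G indep) (subst (n ℕ.≤_) (sym eq) n≤j)) ⟨
      ∑[ i < n ℕ.+ ℕ.suc m ] g (toℕ i)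
        ≡⟨ cong (λ b → ∑[ i < b ] g (toℕ i)) (ℕ.+-comm n (ℕ.suc m)) ⟩
      ∑[ i < ℕ.suc m ℕ.+ n ] g (toℕ i)
        ≈⟨ ∑-extend g (ℕ.suc m) n (λ m<j → g≈0 λ {S} _ eq →
             ℕ.<⇒≱ m<j (subst (ℕ._≤ m) eq (∣p∣≤n S))) ⟩
      ∑[ i ≤ m ] g (toℕ i)
        ≈⟨ *-distribˡ-sum {ℕ.suc m} (x ^ n) (h ∘ toℕ) ⟨
      x ^ n * independencePolynomial R Ĝ x⁻¹
        ∎
      where
      Ĝ = conflictGraph G
      m = length (edges G)
      h g : ℕ → Carrier
      h j = (- 1#) ^ j * (independentSetCount Ĝ j · x⁻¹ ^ j)
      g j = x ^ n * h j

      g≈0 : ∀ {j} → (∀ {S} → IsIndependent Ĝ S → ∣ S ∣ ≢ j) → g j ≈ 0#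
      g≈0 {j} none = begin
        -- With count 0 the multiple `0 · x⁻¹ ^ j` computes to `0#`.
        g j ≡⟨ cong (λ a → x ^ n * ((- 1#) ^ j * (a · x⁻¹ ^ j))) (independentSetCount≡0 Ĝ none) ⟩
        x ^ n * ((- 1#) ^ j * 0#) ≈⟨ *-congˡ (zeroʳ _) ⟩
        x ^ n * 0# ≈⟨ zeroʳ _ ⟩
        0# ∎

      term : ∀ i → let k = ℕ.suc (toℕ i) in
        (- 1#) ^ (n ℕ.∸ k) * (cliquePartitionCount G k · x ^ k) ≈ g (toℕ (opposite i))
      term i = begin
        (- 1#) ^ (n ℕ.∸ k) * (cliquePartitionCount G k · x ^ k)
          ≡⟨ cong (λ a → (- 1#) ^ (n ℕ.∸ k) * (a · x ^ k))
               (cliquePartitionCount≡independentSetCount G (toℕ<n i)) ⟩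
        (- 1#) ^ (n ℕ.∸ k) * (independentSetCount Ĝ (n ℕ.∸ k) · x ^ k)
          ≈⟨ reciprocal-term _ (independentSetCount Ĝ (n ℕ.∸ k)) (toℕ<n i) ⟩
        g (n ℕ.∸ k)
          ≡⟨ cong g (opposite-prop i) ⟨
        g (toℕ (opposite i))
          ∎
        where k = ℕ.suc (toℕ i)

-- The graph is chosen before the ring, so one graph serves all rings. Taking `x` to be the
-- indeterminate of the Laurent polynomial ring over the integers recovers the formal identity with
-- `1/x`.
theorem1 : ∀ {c ℓ} (n : ℕ) .{{_ : NonZero n}} (G : Graph n) →
    ∃[ m ] Σ[ Ĝ ∈ Graph m ]
      ((R : CommutativeRing c ℓ) →
       let open CommutativeRing R
           open Algebra.Properties.Semiring.Exp semiring using (_^_)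
       in (x x⁻¹ : Carrier) → x * x⁻¹ ≈ 1# →
          adjointPolynomial R G x ≈ x ^ n * independencePolynomial R Ĝ x⁻¹)
theorem1 n G = length (edges G) , conflictGraph G , λ R _ _ xx⁻¹≈1 → adjointPolynomial≈ R xx⁻¹≈1 G
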